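{- Let $G = (V,E)$ be a finite simple undirected graph, let $\tau(G)$ be the minimum size of a vertex cover of $G$, and let $\kappa(G)$ be the number of K-sets of $G$. Then $$\kappa(G) \le 3^{\tau(G)} + |V| - \tau(G) - 2^{\tau(G)}.$$
   Context: All graphs are finite, simple and undirected. For $v \in V$, $N_G[v] = \{v\} \cup \{w \in V : \{v,w\} \in E\}$ is the closed neighborhood, and for $X \subseteq V$, $N_G[X] = \bigcup_{v \in X} N_G[v]$ (so $N_G[\emptyset] = \emptyset$). A K-set of $G$ is a non-empty subset $W \subseteq V$ such that the induced subgraph $G[W]$ is connected and there is a (possibly empty) independent set $X \subseteq V$ of $G$ with $W = V \setminus N_G[X]$. -}

module Defs where

open import Data.Fin.Base using (Fin)
open import Data.Fin.Properties using (all?; any?) renaming (_≟_ to _≟ᶠ_)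
open import Data.Fin.Subset using (Subset; inside; outside; _∈_; ∁; ∣_∣; Nonempty)
open import Data.Fin.Subset.Properties using (_∈?_; anySubset?; nonempty?)
open import Data.Bool.Properties using () renaming (_≟_ to _≟ᵇ_)
open import Data.List.Base using (List; []; _∷_; _++_; map; filter; length; allFin)
open import Data.List.Extrema.Nat using (min)
open import Data.List.Membership.Propositional using () renaming (_∈_ to _∈ˡ_)
open import Data.List.Membership.Propositional.Properties using (∈-allFin)
open import Data.List.Relation.Unary.Any using (here; there)
open import Data.Nat.Base using (ℕ; zero; suc)
open import Data.Product.Base using (_×_; _,_; ∃)
open import Data.Sum.Base using (_⊎_; inj₁; inj₂)
open import Data.Vec.Base using ([]; _∷_; tabulate)
open import Data.Vec.Properties using (≡-dec)
open import Level using (0ℓ)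
open import Relation.Binary.Construct.Closure.ReflexiveTransitive using (Star; ε; _◅_; _◅◅_)
open import Relation.Binary.Core using (Rel)
open import Relation.Binary.Definitions using (Symmetric; Irreflexive)
  renaming (Decidable to Decidable₂)
open import Relation.Binary.PropositionalEquality.Core using (_≡_; refl)
open import Relation.Nullary.Decidable.Core
  using (does; map′; ¬?; _×-dec_; _⊎-dec_; _→-dec_)
open import Relation.Nullary.Negation.Core using (¬_)
open import Relation.Unary using (Pred; Decidable)

record Graph (n : ℕ) : Set₁ where
  field
    Adj    : Rel (Fin n) 0ℓ
    adj?   : Decidable₂ Adj
    sym    : Symmetric Adj
    irrefl : Irreflexive _≡_ Adj

comprehension : ∀ {n} {P : Pred (Fin n) 0ℓ} → Decidable P → Subset n
comprehension P? = tabulate (λ i → does (P? i))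

subsets : ∀ n → List (Subset n)
subsets zero    = [] ∷ []
subsets (suc n) = map (inside ∷_) (subsets n) ++ map (outside ∷_) (subsets n)

-- Reachability in a decidable relation on a finite set is decidable (Warshall):
-- Via vs x y says that y is reachable from x with all intermediate points in vs.

module Reachability {n : ℕ} {R : Rel (Fin n) 0ℓ} (R? : Decidable₂ R) where

  Via : List (Fin n) → Rel (Fin n) 0ℓ
  Via []       x y = x ≡ y ⊎ R x y
  Via (v ∷ vs) x y = Via vs x y ⊎ (Via vs x v × Via vs v y)

  via? : ∀ vs → Decidable₂ (Via vs)
  via? []       x y = (x ≟ᶠ y) ⊎-dec R? x y
  via? (v ∷ vs) x y = via? vs x y ⊎-dec (via? vs x v ×-dec via? vs v y)

  via-refl : ∀ vs {x} → Via vs x x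
  via-refl []       = inj₁ refl
  via-refl (v ∷ vs) = inj₁ (via-refl vs)

  via-step : ∀ vs {x y} → R x y → Via vs x y
  via-step []       r = inj₂ r
  via-step (v ∷ vs) r = inj₁ (via-step vs r)

  via-last : ∀ v vs {x} → Via (v ∷ vs) x v → Via vs x v
  via-last v vs (inj₁ p)       = p
  via-last v vs (inj₂ (p , _)) = p

  via-first : ∀ v vs {y} → Via (v ∷ vs) v y → Via vs v y
  via-first v vs (inj₁ p)       = p
  via-first v vs (inj₂ (_ , p)) = p

  via-trans : ∀ vs {x y z} → z ∈ˡ vs → Via vs x z → Via vs z y → Via vs x y
  via-trans (v ∷ vs) (here refl) p q = inj₂ (via-last v vs p , via-first v vs q)
  via-trans (v ∷ vs) (there i) (inj₁ p)        (inj₁ q)       = inj₁ (via-trans vs i p q)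
  via-trans (v ∷ vs) (there i) (inj₁ p)        (inj₂ (q , s)) = inj₂ (via-trans vs i p q , s)
  via-trans (v ∷ vs) (there i) (inj₂ (p , p′)) (inj₁ q)       = inj₂ (p , via-trans vs i p′ q)
  via-trans (v ∷ vs) (there i) (inj₂ (p , _))  (inj₂ (_ , s)) = inj₂ (p , s)

  via⇒star : ∀ vs {x y} → Via vs x y → Star R x y
  via⇒star []       (inj₁ refl)    = ε
  via⇒star []       (inj₂ r)       = r ◅ ε
  via⇒star (v ∷ vs) (inj₁ p)       = via⇒star vs p
  via⇒star (v ∷ vs) (inj₂ (p , q)) = via⇒star vs p ◅◅ via⇒star vs q

  star⇒via : ∀ {x y} → Star R x y → Via (allFin n) x y
  star⇒via ε        = via-refl (allFin n)
  star⇒via (r ◅ rs) = via-trans (allFin n) (∈-allFin _) (via-step (allFin n) r) (star⇒via rs)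

  star? : Decidable₂ (Star R)
  star? x y = map′ (via⇒star (allFin n)) star⇒via (via? (allFin n) x y)

module _ {n : ℕ} (G : Graph n) where

  open Graph G

  N[_] : Fin n → Subset n
  N[ v ] = comprehension (λ w → (v ≟ᶠ w) ⊎-dec adj? v w)

  N[_]ˢ : Subset n → Subset n
  N[ X ]ˢ = comprehension (λ w → any? (λ v → (v ∈? X) ×-dec (w ∈? N[ v ])))

  Independent : Subset n → Set
  Independent X = ∀ u v → u ∈ X → v ∈ X → ¬ Adj u v

  VertexCover : Subset n → Set
  VertexCover C = ∀ u v → Adj u v → u ∈ C ⊎ v ∈ C

  InducedAdj : Subset n → Rel (Fin n) 0ℓ
  InducedAdj W u v = u ∈ W × v ∈ W × Adj u v

  -- Holds vacuously for the empty set; KSet demands non-emptiness separately.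
  InducedConnected : Subset n → Set
  InducedConnected W = ∀ u v → u ∈ W → v ∈ W → Star (InducedAdj W) u v

  KSet : Subset n → Set
  KSet W = Nonempty W × InducedConnected W × ∃ λ X → Independent X × W ≡ ∁ N[ X ]ˢ

  independent? : Decidable Independent
  independent? X = all? λ u → all? λ v → (u ∈? X) →-dec ((v ∈? X) →-dec ¬? (adj? u v))

  vertexCover? : Decidable VertexCover
  vertexCover? C = all? λ u → all? λ v → adj? u v →-dec ((u ∈? C) ⊎-dec (v ∈? C))

  inducedAdj? : ∀ W → Decidable₂ (InducedAdj W)
  inducedAdj? W u v = (u ∈? W) ×-dec ((v ∈? W) ×-dec adj? u v)

  inducedConnected? : Decidable InducedConnected
  inducedConnected? W = all? λ u → all? λ v →
    (u ∈? W) →-dec ((v ∈? W) →-dec Reachability.star? (inducedAdj? W) u v)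

  kSet? : Decidable KSet
  kSet? W = nonempty? W ×-dec (inducedConnected? W ×-dec
    anySubset? (λ X → independent? X ×-dec ≡-dec _≟ᵇ_ W (∁ N[ X ]ˢ)))

  -- The default value n is harmless: it is the size of the cover consisting of
  -- all vertices, which is itself in the list.
  τ : ℕ
  τ = min n (map ∣_∣ (filter vertexCover? (subsets n)))

  κ : ℕ
  κ = length (filter kSet? (subsets n))

{-# OPTIONS --safe #-}

-- Fix a vertex cover C of size τ(G), so that V ∖ C is independent.  A K-set
-- W = V ∖ N[X] disjoint from C is connected without edges, hence one of the
-- |V| - τ(G) singletons outside C.  A K-set W meeting C is determined by the
-- disjoint pair A = W ∩ C, B = X ∩ C: by connectedness every vertex of W ∖ C has
-- a neighbour in A, and a vertex of N[A] ∖ C cannot lie in X (that would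
-- put a vertex of A into N[X]), so it is in W exactly when it is not in N[B].
-- There are 3^τ(G) - 2^τ(G) disjoint pairs of subsets of C with A non-empty.
module Submission where

open import Defs
open import Data.Nat.Base using (ℕ; _^_)
open import Data.Integer.Base using (+_; _+_; _-_; _≤_; +≤+)

import Data.Nat.Base as ℕ
import Data.Nat.Properties as ℕ
import Data.Nat.Tactic.RingSolver as ℕ-Solver
import Data.Integer.Properties as ℤ
import Data.Integer.Tactic.RingSolver as ℤ-Solver
open import Data.Fin.Base using (Fin; zero; suc)
open import Data.Fin.Properties using (_≟_; any?)
open import Data.Fin.Subset
  using (Subset; inside; outside; _∈_; _∉_; _⊆_; _∩_; _∪_; ∁; ⁅_⁆; ∣_∣; Nonempty; ⊤)
open import Data.Fin.Subset.Properties
open import Data.List.Base using (List; []; _∷_; _++_; [_]; map; filter; length)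
open import Data.List.Extrema ℕ.≤-totalOrder using (argmin-sel)
open import Data.List.Membership.Propositional using () renaming (_∈_ to _∈ˡ_)
open import Data.List.Membership.Propositional.Properties
  using (∈-++⁺ˡ; ∈-++⁺ʳ; ∈-++⁻; ∈-∃++; ∈-map⁺; ∈-map⁻; ∈-filter⁻)
open import Data.List.Properties using (length-++; length-map)
open import Data.List.Relation.Binary.Subset.Propositional using () renaming (_⊆_ to _⊆ˡ_)
open import Data.List.Relation.Unary.All as All using ()
open import Data.List.Relation.Unary.AllPairs using ([]; _∷_)
open import Data.List.Relation.Unary.Any using (here; there)
open import Data.List.Relation.Unary.Unique.Propositional using (Unique)
import Data.List.Relation.Unary.Unique.Propositional.Properties as Unique
open import Data.Product.Base using (_×_; _,_; ∃; proj₂)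
open import Data.Sum.Base using (_⊎_; inj₁; inj₂)
open import Data.Vec.Base using ([]; _∷_; here; there)
open import Data.Vec.Properties using (lookup⇒[]=; []=⇒lookup; lookup∘tabulate; ∷-injectiveʳ)
open import Function.Base using (_∘_; id)
open import Level using (0ℓ)
open import Relation.Binary.Construct.Closure.ReflexiveTransitive using (Star; ε; _◅_)
open import Relation.Binary.PropositionalEquality
  using (_≡_; refl; sym; trans; cong; cong₂; subst; module ≡-Reasoning)
open import Relation.Nullary.Decidable using (yes; no; does; dec-true; _×-dec_; _⊎-dec_)
open import Relation.Nullary.Negation using (¬_; contradiction)
open import Relation.Unary using (Pred; Decidable)

-- Counting by lists without repetition.

private
  variable
    n : ℕ

-- Pigeonhole by induction: deleting one occurrence of `x` from `ys` leaves a list that still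
-- contains the tail `xs`, because `x` does not recur in `xs`.
Unique-⊆⇒length≤ : ∀ {A : Set} {xs ys : List A} →
  Unique xs → xs ⊆ˡ ys → length xs ℕ.≤ length ys
Unique-⊆⇒length≤ {xs = []} _ _ = ℕ.z≤n
Unique-⊆⇒length≤ {xs = x ∷ xs} (x∉xs ∷ xs!) xs⊆ys
  with as , bs , refl ← ∈-∃++ (xs⊆ys (here refl)) = begin
  ℕ.suc (length xs)                   ≤⟨ ℕ.s≤s (Unique-⊆⇒length≤ xs! xs⊆as++bs) ⟩
  ℕ.suc (length (as ++ bs))           ≡⟨ cong ℕ.suc (length-++ as) ⟩
  ℕ.suc (length as ℕ.+ length bs)     ≡⟨ ℕ.+-suc (length as) (length bs) ⟨
  length as ℕ.+ ℕ.suc (length bs)     ≡⟨ length-++ as ⟨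
  length (as ++ x ∷ bs)               ∎
  where
  open ℕ.≤-Reasoning
  xs⊆as++bs : xs ⊆ˡ as ++ bs
  xs⊆as++bs y∈xs with ∈-++⁻ as (xs⊆ys (there y∈xs))
  ... | inj₁ y∈as         = ∈-++⁺ˡ y∈as
  ... | inj₂ (here refl)  = contradiction refl (All.lookup x∉xs y∈xs)
  ... | inj₂ (there y∈bs) = ∈-++⁺ʳ as y∈bs

subsets-unique : ∀ n → Unique (subsets n)
subsets-unique ℕ.zero    = All.[] ∷ []
subsets-unique (ℕ.suc n) = Unique.++⁺
  (Unique.map⁺ ∷-injectiveʳ (subsets-unique n))
  (Unique.map⁺ ∷-injectiveʳ (subsets-unique n))
  λ (p , q) → case-heads (∈-map⁻ _ p) (∈-map⁻ _ q)
  where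
  case-heads : ∀ {p} → (∃ λ q → q ∈ˡ subsets n × p ≡ inside ∷ q) →
    ¬ (∃ λ q → q ∈ˡ subsets n × p ≡ outside ∷ q)
  case-heads (_ , _ , refl) (_ , _ , ())

elements : Subset n → List (Fin n)
elements []            = []
elements (inside  ∷ p) = zero ∷ map suc (elements p)
elements (outside ∷ p) = map suc (elements p)

∈-elements : ∀ {x} {p : Subset n} → x ∈ p → x ∈ˡ elements p
∈-elements here = here refl
∈-elements {p = inside  ∷ _} (there x∈p) = there (∈-map⁺ suc (∈-elements x∈p))
∈-elements {p = outside ∷ _} (there x∈p) = ∈-map⁺ suc (∈-elements x∈p)

length-elements : ∀ (p : Subset n) → length (elements p) ≡ ∣ p ∣
length-elements []            = refl
length-elements (inside  ∷ p) =
  cong ℕ.suc (trans (length-map suc (elements p)) (length-elements p))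
length-elements (outside ∷ p) = trans (length-map suc (elements p)) (length-elements p)

-- Enumerating the disjoint pairs of subsets.

consPair : ∀ s t → Subset n × Subset n → Subset (ℕ.suc n) × Subset (ℕ.suc n)
consPair s t (A , B) = s ∷ A , t ∷ B

-- A new element lies in the first component, in the second, or in neither. The first case has its
-- own list of tails `ps`: such an element already makes the first component non-empty, so when
-- non-emptiness is demanded only the tails in `qs` must satisfy it.
branch : (ps qs : List (Subset n × Subset n)) → List (Subset (ℕ.suc n) × Subset (ℕ.suc n))
branch ps qs =
  map (consPair inside outside) ps ++
  map (consPair outside inside) qs ++
  map (consPair outside outside) qs

disjointPairs : Subset n → List (Subset n × Subset n)
disjointPairs []            = [ [] , [] ]
disjointPairs (inside  ∷ C) = branch (disjointPairs C) (disjointPairs C)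
disjointPairs (outside ∷ C) = map (consPair outside outside) (disjointPairs C)

-- The sublist of those pairs whose first component is non-empty.
disjointPairs₁ : Subset n → List (Subset n × Subset n)
disjointPairs₁ []            = []
disjointPairs₁ (inside  ∷ C) = branch (disjointPairs C) (disjointPairs₁ C)
disjointPairs₁ (outside ∷ C) = map (consPair outside outside) (disjointPairs₁ C)

length-branch : ∀ (ps qs : List (Subset n × Subset n)) →
  length (branch ps qs) ≡ length ps ℕ.+ (length qs ℕ.+ length qs)
length-branch ps qs = begin
  length (map io ps ++ map oi qs ++ map oo qs)
    ≡⟨ length-++ (map io ps) ⟩
  length (map io ps) ℕ.+ length (map oi qs ++ map oo qs)
    ≡⟨ cong₂ ℕ._+_ (length-map io ps) (length-++ (map oi qs)) ⟩
  length ps ℕ.+ (length (map oi qs) ℕ.+ length (map oo qs))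
    ≡⟨ cong (length ps ℕ.+_) (cong₂ ℕ._+_ (length-map oi qs) (length-map oo qs)) ⟩
  length ps ℕ.+ (length qs ℕ.+ length qs) ∎
  where
  open ≡-Reasoning
  io = consPair inside outside
  oi = consPair outside inside
  oo = consPair outside outside

module _ {A B : Subset n} (ps qs : List (Subset n × Subset n)) where

  ∈-branch-io : (A , B) ∈ˡ ps → (inside ∷ A , outside ∷ B) ∈ˡ branch ps qs
  ∈-branch-io = ∈-++⁺ˡ ∘ ∈-map⁺ (consPair inside outside)

  ∈-branch-oi : (A , B) ∈ˡ qs → (outside ∷ A , inside ∷ B) ∈ˡ branch ps qs
  ∈-branch-oi = ∈-++⁺ʳ (map (consPair inside outside) ps) ∘ ∈-++⁺ˡ ∘ ∈-map⁺ (consPair outside inside)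

  ∈-branch-oo : (A , B) ∈ˡ qs → (outside ∷ A , outside ∷ B) ∈ˡ branch ps qs
  ∈-branch-oo = ∈-++⁺ʳ (map (consPair inside outside) ps) ∘
    ∈-++⁺ʳ (map (consPair outside inside) qs) ∘ ∈-map⁺ (consPair outside outside)

length-disjointPairs : ∀ (C : Subset n) → length (disjointPairs C) ≡ 3 ^ ∣ C ∣
length-disjointPairs []            = refl
length-disjointPairs (outside ∷ C) =
  trans (length-map _ (disjointPairs C)) (length-disjointPairs C)
length-disjointPairs (inside  ∷ C)
  rewrite length-branch (disjointPairs C) (disjointPairs C)
  | length-disjointPairs C | ℕ.+-identityʳ (3 ^ ∣ C ∣) = refl

-- The pairs left out have an empty first component, one for each subset of `C`. Adding their number
-- on the left avoids truncated subtraction.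
length-disjointPairs₁ : ∀ (C : Subset n) →
  length (disjointPairs₁ C) ℕ.+ 2 ^ ∣ C ∣ ≡ 3 ^ ∣ C ∣
length-disjointPairs₁ []            = refl
length-disjointPairs₁ (outside ∷ C) =
  trans (cong (ℕ._+ 2 ^ ∣ C ∣) (length-map _ (disjointPairs₁ C))) (length-disjointPairs₁ C)
length-disjointPairs₁ (inside  ∷ C)
  rewrite length-branch (disjointPairs C) (disjointPairs₁ C)
  | length-disjointPairs C | sym (length-disjointPairs₁ C)
  = rearrange (length (disjointPairs₁ C)) (2 ^ ∣ C ∣)
  where
  rearrange : ∀ l t → (l ℕ.+ t) ℕ.+ (l ℕ.+ l) ℕ.+ 2 ℕ.* t ≡ 3 ℕ.* (l ℕ.+ t)
  rearrange = ℕ-Solver.solve-∀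

Disjoint : Subset n → Subset n → Set
Disjoint p q = ∀ {x} → x ∈ p → x ∉ q

drop-∷-Disjoint : ∀ {s t} {p q : Subset n} → Disjoint (s ∷ p) (t ∷ q) → Disjoint p q
drop-∷-Disjoint p#q x∈p x∈q = p#q (there x∈p) (there x∈q)

∈-disjointPairs : ∀ {A B C : Subset n} → A ⊆ C → B ⊆ C → Disjoint A B →
  (A , B) ∈ˡ disjointPairs C
∈-disjointPairs {A = []} {[]} {[]} _ _ _ = here refl
∈-disjointPairs {A = s ∷ A} {t ∷ B} {u ∷ C} A⊆C B⊆C A#B = cons s t u A⊆C B⊆C A#B
  where
  rest : (A , B) ∈ˡ disjointPairs C
  rest = ∈-disjointPairs (drop-∷-⊆ A⊆C) (drop-∷-⊆ B⊆C) (drop-∷-Disjoint A#B)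

  -- The heads and the hypotheses about them are arguments, so that `rest` is formed once for all
  -- cases.
  cons : ∀ s t u → s ∷ A ⊆ u ∷ C → t ∷ B ⊆ u ∷ C → Disjoint (s ∷ A) (t ∷ B) →
    (s ∷ A , t ∷ B) ∈ˡ disjointPairs (u ∷ C)
  cons inside  inside  _       _   _   A#B = contradiction here (A#B here)
  cons inside  outside inside  _   _   _   = ∈-branch-io (disjointPairs C) (disjointPairs C) rest
  cons outside inside  inside  _   _   _   = ∈-branch-oi (disjointPairs C) (disjointPairs C) rest
  cons outside outside inside  _   _   _   = ∈-branch-oo (disjointPairs C) (disjointPairs C) rest
  cons inside  outside outside A⊆C _   _   = contradiction (A⊆C here) λ ()
  cons outside inside  outside _   B⊆C _   = contradiction (B⊆C here) λ ()
  cons outside outside outside _   _   _   = ∈-map⁺ (consPair outside outside) rest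

∈-disjointPairs₁ : ∀ {A B C : Subset n} → A ⊆ C → B ⊆ C → Disjoint A B → Nonempty A →
  (A , B) ∈ˡ disjointPairs₁ C
∈-disjointPairs₁ {A = inside ∷ A} {inside ∷ B} _ _ A#B _ = contradiction here (A#B here)
∈-disjointPairs₁ {A = inside ∷ A} {outside ∷ B} {inside ∷ C} A⊆C B⊆C A#B _ =
  ∈-branch-io (disjointPairs C) (disjointPairs₁ C)
    (∈-disjointPairs (drop-∷-⊆ A⊆C) (drop-∷-⊆ B⊆C) (drop-∷-Disjoint A#B))
∈-disjointPairs₁ {A = inside ∷ A} {C = outside ∷ C} A⊆C _ _ _ = contradiction (A⊆C here) λ ()
∈-disjointPairs₁ {A = outside ∷ A} {t ∷ B} {u ∷ C} A⊆C B⊆C A#B (suc x , there x∈A) =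
  cons t u B⊆C
  where
  rest : (A , B) ∈ˡ disjointPairs₁ C
  rest = ∈-disjointPairs₁ (drop-∷-⊆ A⊆C) (drop-∷-⊆ B⊆C) (drop-∷-Disjoint A#B) (x , x∈A)

  cons : ∀ t u → t ∷ B ⊆ u ∷ C → (outside ∷ A , t ∷ B) ∈ˡ disjointPairs₁ (u ∷ C)
  cons inside  inside  _   = ∈-branch-oi (disjointPairs C) (disjointPairs₁ C) rest
  cons outside inside  _   = ∈-branch-oo (disjointPairs C) (disjointPairs₁ C) rest
  cons inside  outside B⊆C = contradiction (B⊆C here) λ ()
  cons outside outside _   = ∈-map⁺ (consPair outside outside) rest

-- Membership in closed neighborhoods, and a minimum vertex cover.

module _ {P : Pred (Fin n) 0ℓ} (P? : Decidable P) where

  ∈-comprehension⁺ : ∀ {x} → P x → x ∈ comprehension P?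
  ∈-comprehension⁺ {x} px =
    lookup⇒[]= x _ (trans (lookup∘tabulate (does ∘ P?) x) (dec-true (P? x) px))

  ∈-comprehension⁻ : ∀ {x} → x ∈ comprehension P? → P x
  -- A negative answer of `P? x` would turn the second equation into `outside ≡ inside`, so only
  -- `yes` remains.
  ∈-comprehension⁻ {x} x∈ with P? x | trans (sym (lookup∘tabulate (does ∘ P?) x)) ([]=⇒lookup x∈)
  ... | yes px | _ = px

module _ (G : Graph n) where

  open Graph G renaming (sym to Adj-sym)

  private
    closedAdj? : ∀ v → Decidable (λ w → v ≡ w ⊎ Adj v w)
    closedAdj? v w = (v ≟ w) ⊎-dec adj? v w

    dominated? : ∀ X → Decidable (λ w → ∃ λ v → v ∈ X × w ∈ N[_] G v)
    dominated? X w = any? (λ v → (v ∈? X) ×-dec (w ∈? N[_] G v))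

  ∈-N⁺ : ∀ {X v w} → v ∈ X → v ≡ w ⊎ Adj v w → w ∈ N[_]ˢ G X
  ∈-N⁺ {X} {v} v∈X v~w =
    ∈-comprehension⁺ (dominated? X) (v , v∈X , ∈-comprehension⁺ (closedAdj? v) v~w)

  ∈-N⁻ : ∀ {X w} → w ∈ N[_]ˢ G X → ∃ λ v → v ∈ X × (v ≡ w ⊎ Adj v w)
  ∈-N⁻ {X} w∈N with v , v∈X , w∈Nv ← ∈-comprehension⁻ (dominated? X) w∈N =
    v , v∈X , ∈-comprehension⁻ (closedAdj? v) w∈Nv

  minimumCover : ∃ λ C → VertexCover G C × τ G ≡ ∣ C ∣
  minimumCover
    with argmin-sel id n (map ∣_∣ (filter (vertexCover? G) (subsets n)))
  -- The minimum may be the default value `n`; the set of all vertices is a cover of that size.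
  ... | inj₁ τ≡n = ⊤ , (λ _ _ _ → inj₁ ∈⊤) , trans τ≡n (sym (∣⊤∣≡n n))
  ... | inj₂ τ∈  with C , C∈ , τ≡ ← ∈-map⁻ ∣_∣ τ∈ =
    C , proj₂ (∈-filter⁻ (vertexCover? G) {xs = subsets n} C∈) , τ≡

  -- K-sets relative to a fixed vertex cover.

  module _ {C : Subset n} (cover : VertexCover G C) where

    -- Meant for `A = W ∩ C` and `B = X ∩ C`. The map goes from pairs to sets because several `X`
    -- may yield the same `W`; for the count, the K-sets meeting `C` only have to lie in its image.
    decode : Subset n × Subset n → Subset n
    decode (A , B) = A ∪ (∁ C ∩ (N[_]ˢ G A ∩ ∁ (N[_]ˢ G B)))

    candidates : List (Subset n)
    candidates = map decode (disjointPairs₁ C) ++ map ⁅_⁆ (elements (∁ C))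

    length-candidates : length candidates ≡ length (disjointPairs₁ C) ℕ.+ ∣ ∁ C ∣
    length-candidates = begin
      length candidates
        ≡⟨ length-++ (map decode (disjointPairs₁ C)) ⟩
      length (map decode (disjointPairs₁ C)) ℕ.+ length (map ⁅_⁆ (elements (∁ C)))
        ≡⟨ cong₂ ℕ._+_ (length-map decode (disjointPairs₁ C)) (length-map ⁅_⁆ (elements (∁ C))) ⟩
      length (disjointPairs₁ C) ℕ.+ length (elements (∁ C))
        ≡⟨ cong (length (disjointPairs₁ C) ℕ.+_) (length-elements (∁ C)) ⟩
      length (disjointPairs₁ C) ℕ.+ ∣ ∁ C ∣ ∎
      where open ≡-Reasoning

    -- A non-trivial path from `w` would begin with an edge inside `W`, and `C` contains one of its
    -- endpoints.
    connected⇒singleton : ∀ {W w} → InducedConnected G W → w ∈ W →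
      (∀ {v} → v ∈ W → v ∉ C) → W ≡ ⁅ w ⁆
    connected⇒singleton {W} {w} conn w∈W W#C = ⊆-antisym
      (λ {v} v∈W → isStart (conn w v w∈W v∈W))
      (λ v∈⁅w⁆ → subst (_∈ W) (sym (x∈⁅y⁆⇒x≡y w v∈⁅w⁆)) w∈W)
      where
      isStart : ∀ {v} → Star (InducedAdj G W) w v → v ∈ ⁅ w ⁆
      isStart ε = x∈⁅x⁆ w
      isStart ((w∈W , u∈W , w~u) ◅ _) with cover _ _ w~u
      ... | inj₁ w∈C = contradiction w∈C (W#C w∈W)
      ... | inj₂ u∈C = contradiction u∈C (W#C u∈W)

    KSet⇒decode : ∀ {W X} → InducedConnected G W → Nonempty (W ∩ C) →
      W ≡ ∁ (N[_]ˢ G X) → W ≡ decode (W ∩ C , X ∩ C)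
    KSet⇒decode {W} {X} conn (a , a∈A) W≡ = ⊆-antisym W⊆ ⊆W
      where
      A = W ∩ C
      B = X ∩ C

      ∈W⇒∉N : ∀ {v} → v ∈ W → v ∉ N[_]ˢ G X
      ∈W⇒∉N v∈W = x∈∁p⇒x∉p (subst (_ ∈_) W≡ v∈W)

      -- The path has a first edge, since `a` is in `C` and `v` is not. As `C` covers that edge, its
      -- other endpoint lies in `W ∩ C`.
      ∈N[A] : ∀ {v} → v ∉ C → Star (InducedAdj G W) v a → v ∈ N[_]ˢ G A
      ∈N[A] v∉C ε = contradiction (p∩q⊆q W C a∈A) v∉C
      ∈N[A] v∉C ((_ , u∈W , v~u) ◅ _) with cover _ _ v~u
      ... | inj₁ v∈C = contradiction v∈C v∉C
      ... | inj₂ u∈C = ∈-N⁺ (x∈p∩q⁺ (u∈W , u∈C)) (inj₂ (Adj-sym v~u))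

      W⊆ : W ⊆ decode (A , B)
      W⊆ {v} v∈W with v ∈? C
      ... | yes v∈C = x∈p∪q⁺ (inj₁ (x∈p∩q⁺ (v∈W , v∈C)))
      ... | no  v∉C = x∈p∪q⁺ (inj₂ (x∈p∩q⁺ (x∉p⇒x∈∁p v∉C ,
        x∈p∩q⁺ (∈N[A] v∉C (conn v a v∈W (p∩q⊆p W C a∈A)) , x∉p⇒x∈∁p v∉N[B]))))
        where
        v∉N[B] : v ∉ N[_]ˢ G B
        v∉N[B] v∈N with b , b∈B , b~v ← ∈-N⁻ v∈N = ∈W⇒∉N v∈W (∈-N⁺ (p∩q⊆p X C b∈B) b~v)

      ⊆W : decode (A , B) ⊆ W
      ⊆W {v} v∈ with x∈p∪q⁻ A _ v∈
      ... | inj₁ v∈A = p∩q⊆p W C v∈A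
      ... | inj₂ v∈R = subst (v ∈_) (sym W≡) (x∉p⇒x∈∁p v∉N[X])
        where
        v∉C : v ∉ C
        v∉C = x∈∁p⇒x∉p (p∩q⊆p _ _ v∈R)

        v∈N[A]∖N[B] : v ∈ N[_]ˢ G A ∩ ∁ (N[_]ˢ G B)
        v∈N[A]∖N[B] = p∩q⊆q (∁ C) _ v∈R

        -- If `v` were in `X`, its neighbour `u` in `A` would be dominated by `X`, although `u` lies
        -- in `W`.
        v∉X : v ∉ X
        v∉X v∈X with ∈-N⁻ (p∩q⊆p _ _ v∈N[A]∖N[B])
        ... | u , u∈A , inj₁ refl = v∉C (p∩q⊆q W C u∈A)
        ... | u , u∈A , inj₂ u~v  = ∈W⇒∉N (p∩q⊆p W C u∈A) (∈-N⁺ v∈X (inj₂ (Adj-sym u~v)))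

        -- A vertex `x` of `X` dominating `v` is not `v` itself, so it is a neighbour; since `v` is
        -- outside `C`, `x` lies in `C` and hence in `B`.
        v∉N[X] : v ∉ N[_]ˢ G X
        v∉N[X] v∈N with ∈-N⁻ v∈N
        ... | x , x∈X , inj₁ refl = v∉X x∈X
        ... | x , x∈X , inj₂ x~v with cover _ _ x~v
        ...   | inj₂ v∈C = v∉C v∈C
        ...   | inj₁ x∈C = x∈∁p⇒x∉p (p∩q⊆q (N[_]ˢ G A) _ v∈N[A]∖N[B])
            (∈-N⁺ (x∈p∩q⁺ (x∈X , x∈C)) (inj₂ x~v))

    KSet⇒∈-candidates : ∀ {W} → KSet G W → W ∈ˡ candidates
    KSet⇒∈-candidates {W} ((w , w∈W) , conn , X , _ , W≡) with nonempty? (W ∩ C)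
    ... | yes A≢∅ = ∈-++⁺ˡ (subst (_∈ˡ map decode (disjointPairs₁ C))
      (sym (KSet⇒decode conn A≢∅ W≡))
      (∈-map⁺ decode (∈-disjointPairs₁ (p∩q⊆q W C) (p∩q⊆q X C) A#B A≢∅)))
      where
      -- Each vertex of `X` dominates itself, whereas `W` avoids everything dominated by `X`.
      A#B : Disjoint (W ∩ C) (X ∩ C)
      A#B x∈A x∈B = x∈∁p⇒x∉p (subst (_ ∈_) W≡ (p∩q⊆p W C x∈A))
        (∈-N⁺ (p∩q⊆p X C x∈B) (inj₁ refl))
    ... | no  A≡∅ = ∈-++⁺ʳ _ (subst (_∈ˡ map ⁅_⁆ (elements (∁ C)))
      (sym (connected⇒singleton conn w∈W W#C))
      (∈-map⁺ ⁅_⁆ (∈-elements (x∉p⇒x∈∁p (W#C w∈W)))))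
      where
      W#C : ∀ {v} → v ∈ W → v ∉ C
      W#C v∈W v∈C = A≡∅ (_ , x∈p∩q⁺ (v∈W , v∈C))

    -- `κ` is the length of a repetition-free list of K-sets, so pigeonhole applies. Repeated
    -- entries or other sets among the `candidates` are harmless for an upper bound.
    κ-bound : κ G ℕ.≤ length (disjointPairs₁ C) ℕ.+ ∣ ∁ C ∣
    κ-bound = subst (κ G ℕ.≤_) length-candidates (Unique-⊆⇒length≤
      (Unique.filter⁺ (kSet? G) (subsets-unique n))
      λ W∈ → KSet⇒∈-candidates (proj₂ (∈-filter⁻ (kSet? G) {xs = subsets n} W∈)))

-- The bound over the integers.

theorem6 : ∀ (n : ℕ) (G : Graph n) →
    + κ G ≤ + (3 ^ τ G) + + n - + τ G - + (2 ^ τ G)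
theorem6 n G with C , cover , τ≡ ← minimumCover G rewrite τ≡ =
  ℤ.≤-trans (+≤+ (κ-bound G cover)) (ℤ.≤-reflexive count)
  where
  p = length (disjointPairs₁ C)
  s = ∣ ∁ C ∣

  s+∣C∣≡n : s ℕ.+ ∣ C ∣ ≡ n
  s+∣C∣≡n = trans (cong (ℕ._+ ∣ C ∣) (∣∁p∣≡n∸∣p∣ C)) (ℕ.m∸n+n≡m (∣p∣≤n C))

  -- Here `t` is `2 ^ ∣ C ∣`, so `p + t` becomes `3 ^ ∣ C ∣` and `s + c` becomes `n`: the right-hand
  -- side of the theorem is exactly the number of candidates.
  rearrange : ∀ p s c t → p + s ≡ (p + t) + (s + c) - c - t
  rearrange = ℤ-Solver.solve-∀

  count : + (p ℕ.+ s) ≡ + (3 ^ ∣ C ∣) + + n - + ∣ C ∣ - + (2 ^ ∣ C ∣)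
  count = trans (rearrange (+ p) (+ s) (+ ∣ C ∣) (+ (2 ^ ∣ C ∣)))
    (cong₂ (λ a b → + a + + b - + ∣ C ∣ - + (2 ^ ∣ C ∣)) (length-disjointPairs₁ C) s+∣C∣≡n)
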